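{- Let $G\subseteq\binom{[n]}{2}$ be a Bernstein-orientable graph. Then for every prime $p$ (and for $p=0$), $G$ is $\mathcal{H}_{n,p}$-independent.
   Context: An alternating closed trail in an oriented graph is a cyclic sequence of distinct arcs $e_0,e_1,\dots,e_{2m}=e_0$ such that (indices mod $2m$) for each $i$ the arcs $e_i$ and $e_{i+1}$ share a vertex $v_i$ and are both directed into $v_i$ or both directed out of $v_i$, and $v_i\neq v_{i+1}$ for each $i$ (non-consecutive $v_i,v_j$ may coincide). An oriented graph is Bernstein if it has no directed cycle and no alternating closed trail; an undirected graph is Bernstein-orientable if it has a Bernstein orientation. For $p$ prime let $K_p=\mathbb{F}_p(r_1,\dots,r_n,b_1,\dots,b_n)$ and for $p=0$ let $K_0=\mathbb{Q}(r_1,\dots,r_n,b_1,\dots,b_n)$, with independent indeterminates $r_i,b_i$. Let $M_n$ be the $\binom{n}{2}\times 2n$ matrix over $K_p$ whose row indexed by $\{i,j\}$, $1\le i<j\le n$, has entries $r_j,b_j,-r_i,-b_i$ in columns $2i-1,2i,2j-1,2j$ respectively and $0$ elsewhere. $\mathcal{H}_{n,p}$ is the row matroid of $M_n$ over $K_p$ (on ground set $\binom{[n]}{2}$); $G$ is $\mathcal{H}_{n,p}$-independent iff the rows indexed by the edges of $G$ are linearly independent over $K_p$. -}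

module Defs where

open import Data.Nat as ℕ using (ℕ; zero; suc)
open import Data.Nat.Primality using (Prime)
open import Data.Integer as ℤ using (ℤ; +_; -_)
open import Data.Integer.Divisibility using (_∣_)
open import Data.Fin as Fin using (Fin; zero; suc)
open import Data.Bool using (Bool; true; false; if_then_else_)
open import Data.Vec as Vec using (Vec)
import Data.Vec.Properties as VecP
open import Data.List as List using (List; []; _∷_; _++_; length; lookup; allFin; foldr)
open import Data.List.Relation.Unary.All using (All)
open import Data.List.Relation.Unary.Unique.Propositional using (Unique)
open import Data.Product using (Σ; _×_; _,_; proj₁; proj₂; ∃-syntax)
open import Data.Sum using (_⊎_)
open import Relation.Binary.PropositionalEquality using (_≡_; _≢_)
open import Relation.Nullary using (¬_; yes; no)
open import Function.Definitions using (Injective)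
import Data.Fin.Properties as FinP

Edge : ℕ → Set
Edge n = Fin n × Fin n

IsGraph : ∀ {n} → List (Edge n) → Set
IsGraph G = All (λ e → proj₁ e Fin.< proj₂ e) G × Unique G

-- cyclic successor on Fin (suc k): i ↦ i + 1 mod (suc k)
cyc : ∀ {k} → Fin (suc k) → Fin (suc k)
cyc {zero} zero = zero
cyc {suc k} zero = suc zero
cyc {suc k} (suc i) with cyc {k} i
... | zero = zero
... | suc j = suc (suc j)

Orientation : ∀ {n} → List (Edge n) → Set
Orientation G = Fin (length G) → Bool

tail head : ∀ {n} (G : List (Edge n)) → Orientation G → Fin (length G) → Fin n
tail G o a = if o a then proj₁ (lookup G a) else proj₂ (lookup G a)
head G o a = if o a then proj₂ (lookup G a) else proj₁ (lookup G a)

DirectedCycle : ∀ {n} (G : List (Edge n)) → Orientation G → Set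
DirectedCycle {n} G o =
  Σ ℕ λ k → Σ (Fin (suc (suc k)) → Fin n) λ v →
    Injective _≡_ _≡_ v ×
    (∀ i → ∃[ a ] (tail G o a ≡ v i × head G o a ≡ v (cyc i)))

AlternatingClosedTrail : ∀ {n} (G : List (Edge n)) → Orientation G → Set
AlternatingClosedTrail {n} G o =
  Σ ℕ λ m → Σ (Fin (2 ℕ.* suc m) → Fin (length G)) λ e →
    Σ (Fin (2 ℕ.* suc m) → Fin n) λ v →
      Injective _≡_ _≡_ e ×
      (∀ i → ((head G o (e i) ≡ v i × head G o (e (cyc i)) ≡ v i)
             ⊎ (tail G o (e i) ≡ v i × tail G o (e (cyc i)) ≡ v i))
           × v i ≢ v (cyc i))

IsBernstein : ∀ {n} (G : List (Edge n)) → Orientation G → Set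
IsBernstein G o = ¬ DirectedCycle G o × ¬ AlternatingClosedTrail G o

BernsteinOrientable : ∀ {n} → List (Edge n) → Set
BernsteinOrientable G = Σ (Orientation G) (IsBernstein G)

-- Polynomials in r₁…rₙ, b₁…bₙ with coefficients in ℤ, read modulo p
-- (p prime gives 𝔽_p[r,b]; p = 0 gives ℤ[r,b] ⊆ ℚ[r,b]).

-- exponent vectors of r and of b
Monomial : ℕ → Set
Monomial n = Vec ℕ n × Vec ℕ n

_≟M_ : ∀ {n} (x y : Monomial n) → Relation.Nullary.Dec (x ≡ y)
(a , b) ≟M (c , d) with VecP.≡-dec ℕ._≟_ a c | VecP.≡-dec ℕ._≟_ b d
... | yes Relation.Binary.PropositionalEquality.refl | yes Relation.Binary.PropositionalEquality.refl = yes Relation.Binary.PropositionalEquality.refl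
... | no ne | _ = no λ { Relation.Binary.PropositionalEquality.refl → ne Relation.Binary.PropositionalEquality.refl }
... | yes _ | no ne = no λ { Relation.Binary.PropositionalEquality.refl → ne Relation.Binary.PropositionalEquality.refl }

Poly : ℕ → Set
Poly n = List (ℤ × Monomial n)

coeff : ∀ {n} → Poly n → Monomial n → ℤ
coeff [] m = + 0
coeff ((c , m') ∷ f) m with m' ≟M m
... | yes _ = c ℤ.+ coeff f m
... | no _ = coeff f m

-- f is the zero polynomial over 𝔽_p (resp. over ℚ when p = 0)
IsZeroP : ∀ {n} → ℕ → Poly n → Set
IsZeroP p f = ∀ m → (+ p) ∣ coeff f m

_+P_ : ∀ {n} → Poly n → Poly n → Poly n
f +P g = f ++ g

_*P_ : ∀ {n} → Poly n → Poly n → Poly n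
f *P g = List.concatMap (λ t → List.map (λ s →
  (proj₁ t ℤ.* proj₁ s ,
   (Vec.zipWith ℕ._+_ (proj₁ (proj₂ t)) (proj₁ (proj₂ s)) ,
    Vec.zipWith ℕ._+_ (proj₂ (proj₂ t)) (proj₂ (proj₂ s))))) g) f

-P_ : ∀ {n} → Poly n → Poly n
-P f = List.map (λ t → (- proj₁ t , proj₂ t)) f

oneM : ∀ {n} → Monomial n
oneM = (Vec.replicate _ 0 , Vec.replicate _ 0)

1P : ∀ {n} → Poly n
1P = (+ 1 , oneM) ∷ []

0P : ∀ {n} → Poly n
0P = []

varR varB : ∀ {n} → Fin n → Poly n
varR i = (+ 1 , (Vec.updateAt (Vec.replicate _ 0) i (λ _ → 1) , Vec.replicate _ 0)) ∷ []
varB i = (+ 1 , (Vec.replicate _ 0 , Vec.updateAt (Vec.replicate _ 0) i (λ _ → 1))) ∷ []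

var : ∀ {n} → Fin n → Bool → Poly n
var k true = varR k
var k false = varB k

-- The field K_p = Frac(𝔽_p[r,b]) (resp. ℚ(r,b)) as formal fractions

Frac : ℕ → Set
Frac n = Poly n × Poly n

num den : ∀ {n} → Frac n → Poly n
num = proj₁
den = proj₂

_+F_ : ∀ {n} → Frac n → Frac n → Frac n
(a , b) +F (c , d) = ((a *P d) +P (c *P b) , b *P d)

_*FP_ : ∀ {n} → Frac n → Poly n → Frac n
(a , b) *FP q = (a *P q , b)

0F : ∀ {n} → Frac n
0F = (0P , 1P)

-- A fraction with nonzero denominator is zero in K_p iff its numerator is
IsZeroF : ∀ {n} → ℕ → Frac n → Set
IsZeroF p x = IsZeroP p (num x)

-- The matrix M_n.  Columns 2k-1, 2k are indexed by (k , true), (k , false).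
-- Row {i,j} (i < j): r_j, b_j in columns of i; -r_i, -b_i in columns of j.

entry : ∀ {n} → Edge n → Fin n → Bool → Poly n
entry (i , j) k t with k Fin.≟ i | k Fin.≟ j
... | yes _ | _ = var j t
... | no _ | yes _ = -P (var i t)
... | no _ | no _ = 0P

columnSum : ∀ {n} (G : List (Edge n)) → (Fin (length G) → Frac n) → Fin n → Bool → Frac n
columnSum G c k t = foldr (λ a acc → acc +F (c a *FP entry (lookup G a) k t)) 0F (allFin (length G))

HIndependent : (n p : ℕ) → List (Edge n) → Set
HIndependent n p G =
  (c : Fin (length G) → Frac n) →
  (∀ a → ¬ IsZeroP p (den (c a))) →
  (∀ k t → IsZeroF p (columnSum G c k t)) →
  ∀ a → IsZeroF p (c a)

{-# OPTIONS --safe #-}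
module Submission where

-- Clearing denominators turns a dependency into polynomials W_a with Σ_a W_a (row a) = 0.  The orientation is acyclic, so
-- vertices have heights N decreasing along arcs; give r_i weight N i and b_i weight 0, and consider the pairs (a , m), m a
-- monomial of W_a, for which weight m + N (tail a) is maximal.  In top weight the b-column of a vertex involves only the
-- arcs leaving it and the r-column only the arcs entering it.  So an arc of a maximal pair shares its tail with another
-- such arc, and its head likewise; alternating the two ends gives an infinite non-backtracking alternating walk, which
-- contains an alternating closed trail.  Hence every W_a vanishes, and the polynomial ring being a domain, so do the coefficients.

open import Defs
open import Data.Nat as ℕ using (ℕ; zero; suc; s≤s; z≤n; s≤s⁻¹)
import Data.Nat.Properties as ℕP
import Data.Nat.Divisibility as ℕD
open import Data.Nat.Primality using (Prime; euclidsLemma; ¬prime[1])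
open import Data.Nat.Induction using (<-wellFounded; Acc; acc)
open import Data.Integer as ℤ using (ℤ; +_; ∣_∣)
import Data.Integer.Properties as ℤP
open import Data.Integer.Divisibility using (_∣_)
import Data.Integer.Divisibility.Signed as Signed
open import Data.Integer.Tactic.RingSolver using (solve-∀)
open import Data.Fin as Fin using (Fin; zero; suc; toℕ)
import Data.Fin.Properties as FinP
open import Data.Bool as Bool using (Bool; true; false; not)
open import Data.Bool.Properties using (not-involutive; ¬-not)
open import Data.Vec as Vec using (Vec; []; _∷_)
import Data.Vec.Properties as VecP
open import Data.Vec.Relation.Binary.Lex.Strict as Lex using (Lex-≤; base; this; next)
open import Data.List as List using (List; []; _∷_; _++_; length; lookup; allFin; foldr; filter; tabulate)
open import Data.List.Properties using (length-filter; map-cong)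
open import Data.List.Membership.Propositional using (_∈_; find; lose)
open import Data.List.Membership.Propositional.Properties using (∈-filter⁺; ∈-map⁺; ∈-concatMap⁺; ∈-allFin; ∈-lookup)
open import Data.List.Relation.Unary.Any as Any using (here; there)
open import Data.List.Relation.Unary.All as All using (All; []; _∷_)
open import Data.List.Relation.Unary.All.Properties as AllP using (all-filter)
import Data.List.Extrema as Extrema
open import Data.List.Extrema.Nat using (max; xs≤max; max≤v⁺)
open import Data.Product using (Σ; ∃; ∃₂; _×_; _,_; proj₁; proj₂; ∃-syntax)
open import Data.Sum using (_⊎_; inj₁; inj₂)
open import Function using (_∘_; id)
open import Level using (0ℓ)
open import Relation.Binary.Bundles using (TotalOrder)
open import Relation.Binary.PropositionalEquality
open import Relation.Binary using (tri<; tri≈; tri>)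
open import Relation.Nullary using (¬_; Dec; yes; no; contradiction)
open import Relation.Nullary.Decidable using (map′; ¬?; _×-dec_; decidable-stable)
open import Relation.Unary using (Pred; Decidable)

-- Maximal elements under a key

module _ {A : Set} (O : TotalOrder 0ℓ 0ℓ 0ℓ) where
  open TotalOrder O using (Carrier; _≤_)
  open Extrema O

  maximal : (key : A → Carrier) {Q : Pred A 0ℓ} → Decidable Q → (xs : List A) → ∃ Q →
            ∃[ y ] (Q y × (∀ {z} → z ∈ xs → Q z → key z ≤ key y))
  maximal key Q? xs (x , qx) =
      -- The given witness `x` is the default of `argmax`, so the filtered list may be empty and `x`
      -- need not lie in `xs`.
      argmax key x (filter Q? xs)
    , argmax-all key qx (all-filter Q? xs)
    , λ z∈xs qz → All.lookup (f[xs]≤f[argmax] x (filter Q? xs)) (∈-filter⁺ Q? z∈xs qz)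

-- Monomials

infixl 6 _⊕_

_⊕_ : ∀ {n} → Monomial n → Monomial n → Monomial n
(a , b) ⊕ (c , d) = Vec.zipWith ℕ._+_ a c , Vec.zipWith ℕ._+_ b d

⊕-assoc : ∀ {n} (x y z : Monomial n) → (x ⊕ y) ⊕ z ≡ x ⊕ (y ⊕ z)
⊕-assoc (a , b) (c , d) (e , f) =
  cong₂ _,_ (VecP.zipWith-assoc ℕP.+-assoc a c e) (VecP.zipWith-assoc ℕP.+-assoc b d f)

⊕-comm : ∀ {n} (x y : Monomial n) → x ⊕ y ≡ y ⊕ x
⊕-comm (a , b) (c , d) = cong₂ _,_ (VecP.zipWith-comm ℕP.+-comm a c) (VecP.zipWith-comm ℕP.+-comm b d)

⊕-swapʳ : ∀ {n} (x y z : Monomial n) → (x ⊕ y) ⊕ z ≡ (x ⊕ z) ⊕ y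
⊕-swapʳ x y z = trans (⊕-assoc x y z) (trans (cong (x ⊕_) (⊕-comm y z)) (sym (⊕-assoc x z y)))

zipWith-+-cancelʳ : ∀ {n} (xs ys zs : Vec ℕ n) → Vec.zipWith ℕ._+_ xs zs ≡ Vec.zipWith ℕ._+_ ys zs → xs ≡ ys
zipWith-+-cancelʳ [] [] [] _ = refl
zipWith-+-cancelʳ (x ∷ xs) (y ∷ ys) (z ∷ zs) eq =
  cong₂ _∷_ (ℕP.+-cancelʳ-≡ z x y (VecP.∷-injectiveˡ eq)) (zipWith-+-cancelʳ xs ys zs (VecP.∷-injectiveʳ eq))

⊕-cancelʳ : ∀ {n} (x y z : Monomial n) → x ⊕ z ≡ y ⊕ z → x ≡ y
⊕-cancelʳ (a , b) (c , d) (e , f) eq =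
  cong₂ _,_ (zipWith-+-cancelʳ a c e (cong proj₁ eq)) (zipWith-+-cancelʳ b d f (cong proj₂ eq))

lexOrder : ℕ → TotalOrder 0ℓ 0ℓ 0ℓ
lexOrder = Lex.≤-totalOrder ℕP.<-strictTotalOrder

exponents : ∀ {n} → Monomial n → Vec ℕ (n ℕ.+ n)
exponents (a , b) = a Vec.++ b

exponents-⊕ : ∀ {n} (x y : Monomial n) → exponents (x ⊕ y) ≡ Vec.zipWith ℕ._+_ (exponents x) (exponents y)
exponents-⊕ (a , b) (c , d) = sym (VecP.zipWith-++ ℕ._+_ a b c d)

_≤lex_ : ∀ {n} → Vec ℕ n → Vec ℕ n → Set
_≤lex_ = Lex-≤ _≡_ ℕ._<_

-- Addition is strictly monotone for the lexicographic order: at the first coordinate where `s` or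
-- `t` drops strictly, the sum drops too. Equality of sums therefore leaves no strict drop.
zipWith-+-extremal : ∀ {n} {a b s t : Vec ℕ n} → s ≤lex a → t ≤lex b →
  Vec.zipWith ℕ._+_ s t ≡ Vec.zipWith ℕ._+_ a b → s ≡ a
zipWith-+-extremal (base _) _ _ = refl
zipWith-+-extremal (this s<a _) (this t<b _) eq =
  contradiction (VecP.∷-injectiveˡ eq) (ℕP.<⇒≢ (ℕP.+-mono-< s<a t<b))
zipWith-+-extremal (this s<a _) (next refl _) eq =
  contradiction (VecP.∷-injectiveˡ eq) (ℕP.<⇒≢ (ℕP.+-monoˡ-< _ s<a))
zipWith-+-extremal (next refl _) (this t<b _) eq =
  contradiction (VecP.∷-injectiveˡ eq) (ℕP.<⇒≢ (ℕP.+-monoʳ-< _ t<b))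
zipWith-+-extremal (next refl s≤a) (next refl t≤b) eq =
  cong (_ ∷_) (zipWith-+-extremal s≤a t≤b (VecP.∷-injectiveʳ eq))

⊕-extremal : ∀ {n} {a b s t : Monomial n} → exponents s ≤lex exponents a → exponents t ≤lex exponents b →
  s ⊕ t ≡ a ⊕ b → s ≡ a
⊕-extremal {a = a} {b} {s} {t} s≤a t≤b eq =
  let (eq₁ , eq₂) = VecP.++-injective (proj₁ s) (proj₁ a) (zipWith-+-extremal s≤a t≤b
        (trans (sym (exponents-⊕ s t)) (trans (cong exponents eq) (exponents-⊕ a b))))
  in cong₂ _,_ eq₁ eq₂

-- Weighted degree in the variables r

weightV : ∀ {n} → (Fin n → ℕ) → Vec ℕ n → ℕ
weightV N [] = 0
weightV N (x ∷ xs) = x ℕ.* N zero ℕ.+ weightV (N ∘ suc) xs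

weightV-+ : ∀ {n} (N : Fin n → ℕ) (xs ys : Vec ℕ n) →
  weightV N (Vec.zipWith ℕ._+_ xs ys) ≡ weightV N xs ℕ.+ weightV N ys
weightV-+ N [] [] = refl
weightV-+ N (x ∷ xs) (y ∷ ys) = trans
  (cong₂ ℕ._+_ (ℕP.*-distribʳ-+ (N zero) x y) (weightV-+ (N ∘ suc) xs ys))
  (interchange (x ℕ.* N zero) _ _ _)
  where open import Algebra.Properties.CommutativeSemigroup ℕP.+-commutativeSemigroup using (interchange)

weightV-0 : ∀ {n} (N : Fin n → ℕ) → weightV N (Vec.replicate n 0) ≡ 0
weightV-0 {zero} N = refl
weightV-0 {suc n} N = weightV-0 (N ∘ suc)

weightV-unit : ∀ {n} (N : Fin n → ℕ) j → weightV N (Vec.updateAt (Vec.replicate n 0) j (λ _ → 1)) ≡ N j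
weightV-unit N zero = trans (cong₂ ℕ._+_ (ℕP.*-identityˡ (N zero)) (weightV-0 (N ∘ suc))) (ℕP.+-identityʳ _)
weightV-unit N (suc j) = weightV-unit (N ∘ suc) j

weight : ∀ {n} → (Fin n → ℕ) → Monomial n → ℕ
weight N m = weightV N (proj₁ m)

varM : ∀ {n} → Fin n → Bool → Monomial n
varM j true = Vec.updateAt (Vec.replicate _ 0) j (λ _ → 1) , Vec.replicate _ 0
varM j false = Vec.replicate _ 0 , Vec.updateAt (Vec.replicate _ 0) j (λ _ → 1)

-- Polynomials as functionals: evalAt φ is the linear extension of φ to polynomials.

evalAt : ∀ {n} → (Monomial n → ℤ) → Poly n → ℤ
evalAt φ [] = + 0
evalAt φ ((c , m) ∷ f) = c ℤ.* φ m ℤ.+ evalAt φ f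

δ : ∀ {n} → Monomial n → Monomial n → ℤ
δ M m with m ≟M M
... | yes _ = + 1
... | no _ = + 0

δ-diag : ∀ {n} (m : Monomial n) → δ m m ≡ + 1
δ-diag m with m ≟M m
... | yes _ = refl
... | no m≢m = contradiction refl m≢m

δ-off : ∀ {n} {M m : Monomial n} → m ≢ M → δ M m ≡ + 0
δ-off {M = M} {m} m≢M with m ≟M M
... | yes m≡M = contradiction m≡M m≢M
... | no _ = refl

δ-shift : ∀ {n} (M m u : Monomial n) → δ (M ⊕ u) (m ⊕ u) ≡ δ M m
δ-shift M m u with m ≟M M
... | yes refl = δ-diag (m ⊕ u)
... | no m≢M = δ-off (m≢M ∘ ⊕-cancelʳ m M u)

coeff≡evalAt-δ : ∀ {n} (f : Poly n) M → coeff f M ≡ evalAt (δ M) f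
coeff≡evalAt-δ [] M = refl
coeff≡evalAt-δ ((c , m) ∷ f) M with m ≟M M
... | yes _ = cong₂ ℤ._+_ (sym (ℤP.*-identityʳ c)) (coeff≡evalAt-δ f M)
... | no _ = trans (coeff≡evalAt-δ f M) (trans (sym (ℤP.+-identityˡ _)) (cong (ℤ._+ _) (sym (ℤP.*-zeroʳ c))))

evalAt-cong : ∀ {n} {φ ψ : Monomial n → ℤ} → (∀ m → φ m ≡ ψ m) → ∀ f → evalAt φ f ≡ evalAt ψ f
evalAt-cong eq [] = refl
evalAt-cong eq ((c , m) ∷ f) = cong₂ ℤ._+_ (cong (c ℤ.*_) (eq m)) (evalAt-cong eq f)

evalAt-scale : ∀ {n} (ε : ℤ) (φ : Monomial n → ℤ) f → evalAt (λ m → ε ℤ.* φ m) f ≡ ε ℤ.* evalAt φ f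
evalAt-scale ε φ [] = sym (ℤP.*-zeroʳ ε)
evalAt-scale ε φ ((c , m) ∷ f) = trans (cong (λ z → c ℤ.* (ε ℤ.* φ m) ℤ.+ z) (evalAt-scale ε φ f)) (lemma c ε (φ m) (evalAt φ f))
  where
  lemma : ∀ c ε x y → c ℤ.* (ε ℤ.* x) ℤ.+ ε ℤ.* y ≡ ε ℤ.* (c ℤ.* x ℤ.+ y)
  lemma = solve-∀

evalAt-++ : ∀ {n} (φ : Monomial n → ℤ) f g → evalAt φ (f ++ g) ≡ evalAt φ f ℤ.+ evalAt φ g
evalAt-++ φ [] g = sym (ℤP.+-identityˡ _)
evalAt-++ φ ((c , m) ∷ f) g = trans (cong (λ z → c ℤ.* φ m ℤ.+ z) (evalAt-++ φ f g)) (sym (ℤP.+-assoc (c ℤ.* φ m) _ _))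

-- Turns a product into nested evaluation, so identities between products reduce to identities
-- between monomials under an arbitrary functional.
evalAt-*P : ∀ {n} (φ : Monomial n → ℤ) f g → evalAt φ (f *P g) ≡ evalAt (λ s → evalAt (λ t → φ (s ⊕ t)) g) f
evalAt-*P φ [] g = refl
evalAt-*P φ ((c , m) ∷ f) g = trans (evalAt-++ φ (List.map (λ s → (c ℤ.* proj₁ s , m ⊕ proj₂ s)) g) (f *P g))
  (cong₂ ℤ._+_ (row g) (evalAt-*P φ f g))
  where
  lemma : ∀ c d x y → c ℤ.* d ℤ.* x ℤ.+ c ℤ.* y ≡ c ℤ.* (d ℤ.* x ℤ.+ y)
  lemma = solve-∀
  row : ∀ g → evalAt φ (List.map (λ s → (c ℤ.* proj₁ s , m ⊕ proj₂ s)) g) ≡ c ℤ.* evalAt (λ t → φ (m ⊕ t)) g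
  row [] = sym (ℤP.*-zeroʳ c)
  row ((d , t) ∷ g) = trans (cong (λ z → c ℤ.* d ℤ.* φ (m ⊕ t) ℤ.+ z) (row g)) (lemma c d (φ (m ⊕ t)) _)

evalAt-*P-assoc : ∀ {n} (φ : Monomial n → ℤ) f g h → evalAt φ ((f *P g) *P h) ≡ evalAt φ (f *P (g *P h))
evalAt-*P-assoc φ f g h = begin
  evalAt φ ((f *P g) *P h)                                                    ≡⟨ evalAt-*P φ (f *P g) h ⟩
  evalAt (λ s → evalAt (λ r → φ (s ⊕ r)) h) (f *P g)                          ≡⟨ evalAt-*P _ f g ⟩
  evalAt (λ s → evalAt (λ t → evalAt (λ r → φ ((s ⊕ t) ⊕ r)) h) g) f          ≡⟨ evalAt-cong (λ s → evalAt-cong (λ t → evalAt-cong (λ r → cong φ (⊕-assoc s t r)) h) g) f ⟩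
  evalAt (λ s → evalAt (λ t → evalAt (λ r → φ (s ⊕ (t ⊕ r))) h) g) f          ≡⟨ evalAt-cong (λ s → evalAt-*P _ g h) f ⟨
  evalAt (λ s → evalAt (λ t → φ (s ⊕ t)) (g *P h)) f                          ≡⟨ evalAt-*P φ f (g *P h) ⟨
  evalAt φ (f *P (g *P h))                                                    ∎
  where open ≡-Reasoning

remove : ∀ {n} → Monomial n → Poly n → Poly n
remove M = filter (λ t → ¬? (proj₂ t ≟M M))

-- A list may repeat a monomial, so one coefficient is split off by gathering all of its occurrences
-- at once.
evalAt-remove : ∀ {n} (φ : Monomial n → ℤ) M f → evalAt φ f ≡ coeff f M ℤ.* φ M ℤ.+ evalAt φ (remove M f)
evalAt-remove φ M [] = refl
evalAt-remove φ M ((c , m) ∷ f) with m ≟M M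
... | yes refl = trans (cong (λ z → c ℤ.* φ m ℤ.+ z) (evalAt-remove φ M f)) (lemma c (φ m) (coeff f m) _)
  where
  lemma : ∀ c x d y → c ℤ.* x ℤ.+ (d ℤ.* x ℤ.+ y) ≡ (c ℤ.+ d) ℤ.* x ℤ.+ y
  lemma = solve-∀
... | no _ = trans (cong (λ z → c ℤ.* φ m ℤ.+ z) (evalAt-remove φ M f)) (lemma (c ℤ.* φ m) (coeff f M ℤ.* φ M) _)
  where
  lemma : ∀ x y z → x ℤ.+ (y ℤ.+ z) ≡ y ℤ.+ (x ℤ.+ z)
  lemma = solve-∀

coeff-remove-same : ∀ {n} (M : Monomial n) f → coeff (remove M f) M ≡ + 0
coeff-remove-same M [] = refl
coeff-remove-same M ((c , m) ∷ f) with m ≟M M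
... | yes _ = coeff-remove-same M f
... | no m≢M with m ≟M M
...   | yes m≡M = contradiction m≡M m≢M
...   | no _ = coeff-remove-same M f

coeff-remove-other : ∀ {n} {M m : Monomial n} → m ≢ M → ∀ f → coeff (remove M f) m ≡ coeff f m
coeff-remove-other m≢M [] = refl
coeff-remove-other {M = M} {m} m≢M ((c , m′) ∷ f) with m′ ≟M M
coeff-remove-other {M = M} {m} m≢M ((c , m′) ∷ f) | yes refl with m′ ≟M m
... | yes m′≡m = contradiction (sym m′≡m) m≢M
... | no _ = coeff-remove-other m≢M f
coeff-remove-other {M = M} {m} m≢M ((c , m′) ∷ f) | no _ with m′ ≟M m
... | yes _ = cong (λ z → c ℤ.+ z) (coeff-remove-other m≢M f)
... | no _ = coeff-remove-other m≢M f

-- Clearing denominators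

Σ[] : ∀ {L} → (Fin L → ℤ) → ℤ
Σ[] {zero} x = + 0
Σ[] {suc L} x = x zero ℤ.+ Σ[] (x ∘ suc)

Σ[]-cong : ∀ {L} {x y : Fin L → ℤ} → (∀ a → x a ≡ y a) → Σ[] x ≡ Σ[] y
Σ[]-cong {zero} eq = refl
Σ[]-cong {suc L} eq = cong₂ ℤ._+_ (eq zero) (Σ[]-cong (eq ∘ suc))

∏P : ∀ {n L} → (Fin L → Poly n) → Poly n
∏P {L = zero} d = 1P
∏P {L = suc L} d = ∏P (d ∘ suc) *P d zero

cofactor : ∀ {n L} → (Fin L → Poly n) → Fin L → Poly n
cofactor d zero = ∏P (d ∘ suc)
cofactor d (suc a) = cofactor (d ∘ suc) a *P d zero

-- Generalises the fold in `columnSum`: an arbitrary `g` in place of the identity lets the induction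
-- pass to `g ∘ suc`.
sumF : ∀ {n L} {A : Set} → (A → Frac n) → (Fin L → A) → Frac n
sumF x g = foldr (λ a acc → acc +F x a) 0F (tabulate g)

den-sumF : ∀ {n L} {A : Set} (x : A → Frac n) (g : Fin L → A) → den (sumF x g) ≡ ∏P (den ∘ x ∘ g)
den-sumF {L = zero} x g = refl
den-sumF {L = suc L} x g = cong (_*P den (x (g zero))) (den-sumF x (g ∘ suc))

-- Over the common denominator, each numerator is multiplied by all the other denominators. The
-- statement quantifies over `φ` because the induction absorbs multiplication by `den x₀` into a new
-- functional `φ′`.
evalAt-num-sumF : ∀ {n L} {A : Set} (φ : Monomial n → ℤ) (x : A → Frac n) (g : Fin L → A) →
  evalAt φ (num (sumF x g)) ≡ Σ[] (λ a → evalAt φ (num (x (g a)) *P cofactor (den ∘ x ∘ g) a))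
evalAt-num-sumF {L = zero} φ x g = refl
evalAt-num-sumF {L = suc L} φ x g = begin
  evalAt φ ((num S *P den x₀) ++ (num x₀ *P den S))             ≡⟨ evalAt-++ φ (num S *P den x₀) _ ⟩
  evalAt φ (num S *P den x₀) ℤ.+ evalAt φ (num x₀ *P den S)     ≡⟨ ℤP.+-comm (evalAt φ (num S *P den x₀)) _ ⟩
  evalAt φ (num x₀ *P den S) ℤ.+ evalAt φ (num S *P den x₀)     ≡⟨ cong₂ ℤ._+_ (cong (λ d → evalAt φ (num x₀ *P d)) (den-sumF x (g ∘ suc))) tail-part ⟩
  Σ[] (λ a → evalAt φ (num (x (g a)) *P cofactor (den ∘ x ∘ g) a)) ∎
  where
  open ≡-Reasoning
  x₀ = x (g zero)
  S = sumF x (g ∘ suc)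
  φ′ = λ s → evalAt (λ t → φ (s ⊕ t)) (den x₀)
  tail-part : evalAt φ (num S *P den x₀) ≡ Σ[] (λ a → evalAt φ (num (x (g (suc a))) *P cofactor (den ∘ x ∘ g) (suc a)))
  tail-part = begin
    evalAt φ (num S *P den x₀)   ≡⟨ evalAt-*P φ (num S) (den x₀) ⟩
    evalAt φ′ (num S)            ≡⟨ evalAt-num-sumF φ′ x (g ∘ suc) ⟩
    Σ[] (λ a → evalAt φ′ (num (x (g (suc a))) *P cofactor (den ∘ x ∘ g ∘ suc) a))
      ≡⟨ Σ[]-cong (λ a → trans (sym (evalAt-*P φ (num (x (g (suc a))) *P cofactor (den ∘ x ∘ g ∘ suc) a) (den x₀)))
                               (evalAt-*P-assoc φ (num (x (g (suc a)))) _ (den x₀))) ⟩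
    Σ[] (λ a → evalAt φ (num (x (g (suc a))) *P cofactor (den ∘ x ∘ g) (suc a))) ∎

-- Arithmetic modulo p, with p = 0 allowed: then divisibility by p is vanishing

module Modulo (p : ℕ) (euclid : ∀ x y → p ℕD.∣ x ℕ.* y → p ℕD.∣ x ⊎ p ℕD.∣ y) (p∤1 : ¬ p ℕD.∣ 1) where

  infix 4 _≡₀ _≢₀

  -- A record rather than a synonym, so that the integer can be inferred from the type.
  record _≡₀ (x : ℤ) : Set where
    constructor mk≡₀
    field divides : + p ∣ x
  open _≡₀ public

  _≢₀ : ℤ → Set
  x ≢₀ = ¬ x ≡₀

  _≡₀? : ∀ x → Dec (x ≡₀)
  x ≡₀? = map′ mk≡₀ divides (p ℕD.∣? ∣ x ∣)

  signed : ∀ {x} → x ≡₀ → + p Signed.∣ x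
  signed z = Signed.∣ᵤ⇒∣ (divides z)

  unsigned : ∀ {x} → + p Signed.∣ x → x ≡₀
  unsigned z = mk≡₀ (Signed.∣⇒∣ᵤ z)

  0≡₀ : + 0 ≡₀
  0≡₀ = mk≡₀ (p ℕD.∣0)

  ≡0⇒≡₀ : ∀ {x} → x ≡ + 0 → x ≡₀
  ≡0⇒≡₀ refl = 0≡₀

  +-≡₀ : ∀ {x y} → x ≡₀ → y ≡₀ → x ℤ.+ y ≡₀
  +-≡₀ px py = unsigned (Signed.∣m∣n⇒∣m+n (signed px) (signed py))

  +-cancelʳ-≡₀ : ∀ {x y} → x ℤ.+ y ≡₀ → y ≡₀ → x ≡₀
  +-cancelʳ-≡₀ {x} px+y py = unsigned (Signed.∣m+n∣n⇒∣m {m = x} (signed px+y) (signed py))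

  *-≡₀ʳ : ∀ x {y} → y ≡₀ → x ℤ.* y ≡₀
  *-≡₀ʳ x py = unsigned (Signed.∣n⇒∣m*n x (signed py))

  *-≡₀ˡ : ∀ {x} y → x ≡₀ → x ℤ.* y ≡₀
  *-≡₀ˡ y px = unsigned (Signed.∣m⇒∣m*n y (signed px))

  *-≢₀ : ∀ {x y} → x ≢₀ → y ≢₀ → x ℤ.* y ≢₀
  *-≢₀ {x} {y} x≢₀ y≢₀ xy≡₀ with euclid ∣ x ∣ ∣ y ∣ (subst (p ℕD.∣_) (ℤP.abs-* x y) (divides xy≡₀))
  ... | inj₁ px = x≢₀ (mk≡₀ px)
  ... | inj₂ py = y≢₀ (mk≡₀ py)

  unit-*-≢₀ : ∀ {ε x} → ∣ ε ∣ ≡ 1 → x ≢₀ → ε ℤ.* x ≢₀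
  unit-*-≢₀ {ε} ∣ε∣≡1 = *-≢₀ {ε} (λ pε → p∤1 (subst (p ℕD.∣_) ∣ε∣≡1 (divides pε)))

  Σ[]-≡₀ : ∀ {L} {x : Fin L → ℤ} → (∀ a → x a ≡₀) → Σ[] x ≡₀
  Σ[]-≡₀ {zero} _ = 0≡₀
  Σ[]-≡₀ {suc L} z = +-≡₀ (z zero) (Σ[]-≡₀ (z ∘ suc))

  Σ[]-only : ∀ {L} {x : Fin L → ℤ} a → Σ[] x ≡₀ → (∀ b → b ≢ a → x b ≡₀) → x a ≡₀
  Σ[]-only zero Σ≡₀ others = +-cancelʳ-≡₀ Σ≡₀ (Σ[]-≡₀ (λ b → others (suc b) λ ()))
  Σ[]-only {x = x} (suc a) Σ≡₀ others = Σ[]-only a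
    (+-cancelʳ-≡₀ (subst _≡₀ (ℤP.+-comm (x zero) _) Σ≡₀) (others zero λ ()))
    (λ b b≢a → others (suc b) (b≢a ∘ FinP.suc-injective))

  -- The cancellation principle behind each step of the alternating walk: a nonzero contribution to
  -- a vanishing column sum must be compensated by another arc.
  another-term : ∀ {L} {x : Fin L → ℤ} a → Σ[] x ≡₀ → x a ≢₀ → ∃[ b ] (b ≢ a × x b ≢₀)
  another-term {x = x} a Σ≡₀ xa≢₀ with FinP.any? (λ b → ¬? (b Fin.≟ a) ×-dec ¬? (x b ≡₀?))
  ... | yes found = found
  ... | no none = contradiction
    (Σ[]-only a Σ≡₀ (λ b b≢a → decidable-stable (x b ≡₀?) (λ xb≢₀ → none (b , b≢a , xb≢₀)))) xa≢₀

  evalAt-witness : ∀ {n} {φ : Monomial n → ℤ} f → evalAt φ f ≢₀ → ∃[ m ] φ m ≢₀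
  evalAt-witness [] nz = contradiction 0≡₀ nz
  evalAt-witness {φ = φ} ((c , m) ∷ f) nz with φ m ≡₀?
  ... | no φm≢₀ = m , φm≢₀
  ... | yes φm≡₀ = evalAt-witness f (λ z → nz (+-≡₀ (*-≡₀ʳ c φm≡₀) z))

  δ-≢₀ : ∀ {n} {M m : Monomial n} → δ M m ≢₀ → m ≡ M
  δ-≢₀ {M = M} {m} nz = decidable-stable (m ≟M M) (λ m≢M → nz (≡0⇒≡₀ (δ-off m≢M)))

  coeff-support : ∀ {n} (f : Poly n) {M} → coeff f M ≢₀ → M ∈ List.map proj₂ f
  coeff-support [] nz = contradiction 0≡₀ nz
  coeff-support ((c , m) ∷ f) {M} nz with m ≟M M
  ... | yes refl = here refl
  ... | no _ = there (coeff-support f nz)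

  evalAt-≡₀ : ∀ {n} (φ : Monomial n → ℤ) f → (∀ m → coeff f m ℤ.* φ m ≡₀) → evalAt φ f ≡₀
  evalAt-≡₀ φ f = go f (<-wellFounded (length f))
    where
    go : ∀ f → Acc ℕ._<_ (length f) → (∀ m → coeff f m ℤ.* φ m ≡₀) → evalAt φ f ≡₀
    go [] _ _ = 0≡₀
    -- The hypothesis concerns collected coefficients, not single terms, so every occurrence of `m`
    -- is stripped together; hence the recursion on length.
    go f@((_ , m) ∷ f′) (acc rec) h = subst _≡₀ (sym (evalAt-remove φ m f))
      (+-≡₀ (h m) (go (remove m f) (rec shorter) h′))
      where
      shorter : length (remove m f) ℕ.< length f
      shorter with m ≟M m
      ... | yes _ = s≤s (length-filter _ f′)
      ... | no m≢m = contradiction refl m≢m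
      h′ : ∀ m′ → coeff (remove m f) m′ ℤ.* φ m′ ≡₀
      h′ m′ with m′ ≟M m
      ... | yes refl = *-≡₀ˡ _ (≡0⇒≡₀ (coeff-remove-same m f))
      ... | no m′≢m = subst (λ c → c ℤ.* φ m′ ≡₀) (sym (coeff-remove-other m′≢m f)) (h m′)

  evalAt-only : ∀ {n} (φ : Monomial n → ℤ) f M → (∀ m → m ≢ M → coeff f m ℤ.* φ m ≡₀) →
    evalAt φ f ≡₀ → coeff f M ℤ.* φ M ≡₀
  evalAt-only φ f M others z = +-cancelʳ-≡₀ (subst _≡₀ (evalAt-remove φ M f) z) (evalAt-≡₀ φ (remove M f) rest)
    where
    rest : ∀ m → coeff (remove M f) m ℤ.* φ m ≡₀
    rest m with m ≟M M
    ... | yes refl = *-≡₀ˡ _ (≡0⇒≡₀ (coeff-remove-same M f))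
    ... | no m≢M = subst (λ c → c ℤ.* φ m ≡₀) (sym (coeff-remove-other m≢M f)) (others m m≢M)

  -- Polynomials modulo p form a domain

  NonzeroP : ∀ {n} → Poly n → Set
  NonzeroP f = ∃[ m ] coeff f m ≢₀

  leadingMonomial : ∀ {n} (f : Poly n) → NonzeroP f →
    ∃[ a ] (coeff f a ≢₀ × (∀ m → coeff f m ≢₀ → exponents m ≤lex exponents a))
  leadingMonomial {n} f nz =
    let (a , a-nz , a-max) = maximal (lexOrder (n ℕ.+ n)) exponents (λ m → ¬? (coeff f m ≡₀?)) (List.map proj₂ f) nz
    in a , a-nz , λ m m-nz → a-max (coeff-support f m-nz) m-nz

  -- At the product of the lexicographically leading monomials only the leading pair contributes, by
  -- `⊕-extremal`, and the product of the two leading coefficients is nonzero modulo `p`.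
  *P-nonzero : ∀ {n} (f g : Poly n) → NonzeroP f → NonzeroP g → NonzeroP (f *P g)
  *P-nonzero f g f-nz g-nz with leadingMonomial f f-nz | leadingMonomial g g-nz
  ... | a , a-nz , a-max | b , b-nz , b-max =
    a ⊕ b , λ fg≡₀ → *-≢₀ a-nz (subst _≢₀ (sym Ψa) b-nz)
      (evalAt-only Ψ f a others (subst _≡₀ (trans (coeff≡evalAt-δ (f *P g) (a ⊕ b)) (evalAt-*P _ f g)) fg≡₀))
    where
    Ψ = λ s → evalAt (λ t → δ (a ⊕ b) (s ⊕ t)) g
    Ψa : Ψ a ≡ coeff g b
    Ψa = trans (evalAt-cong (λ t → trans (cong₂ δ (⊕-comm a b) (⊕-comm a t)) (δ-shift b t a)) g)
               (sym (coeff≡evalAt-δ g b))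
    others : ∀ s → s ≢ a → coeff f s ℤ.* Ψ s ≡₀
    others s s≢a with coeff f s ≡₀?
    ... | yes z = *-≡₀ˡ (Ψ s) z
    ... | no s-nz = *-≡₀ʳ (coeff f s) (evalAt-≡₀ (λ t → δ (a ⊕ b) (s ⊕ t)) g term)
      where
      term : ∀ t → coeff g t ℤ.* δ (a ⊕ b) (s ⊕ t) ≡₀
      term t with coeff g t ≡₀?
      ... | yes z = *-≡₀ˡ _ z
      ... | no t-nz = *-≡₀ʳ (coeff g t) (≡0⇒≡₀ (δ-off λ eq → s≢a (⊕-extremal (a-max s s-nz) (b-max t t-nz) eq)))

  -- Constructively valid because only the finitely many listed monomials can have a nonzero
  -- coefficient.
  nonzeroP : ∀ {n} (f : Poly n) → ¬ IsZeroP p f → NonzeroP f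
  nonzeroP f nz with Any.any? (λ m → ¬? (coeff f m ≡₀?)) (List.map proj₂ f)
  ... | yes found = let (m , _ , m-nz) = find found in m , m-nz
  ... | no none = contradiction
    (λ m → divides (decidable-stable (coeff f m ≡₀?) (λ m-nz → none (lose (coeff-support f m-nz) m-nz)))) nz

  1P-nonzero : ∀ {n} → NonzeroP {n} 1P
  1P-nonzero {n} = oneM , λ z → p∤1 (divides (subst _≡₀ (coeff-1P n) z))
    where
    coeff-1P : ∀ n → coeff {n} 1P oneM ≡ + 1
    coeff-1P n = trans (coeff≡evalAt-δ 1P (oneM {n})) (trans (ℤP.+-identityʳ _) (trans (ℤP.*-identityˡ _) (δ-diag (oneM {n}))))

  ∏P-nonzero : ∀ {n L} (d : Fin L → Poly n) → (∀ a → NonzeroP (d a)) → NonzeroP (∏P d)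
  ∏P-nonzero {L = zero} d nz = 1P-nonzero
  ∏P-nonzero {L = suc L} d nz = *P-nonzero (∏P (d ∘ suc)) (d zero) (∏P-nonzero (d ∘ suc) (nz ∘ suc)) (nz zero)

  cofactor-nonzero : ∀ {n L} (d : Fin L → Poly n) → (∀ a → NonzeroP (d a)) → ∀ a → NonzeroP (cofactor d a)
  cofactor-nonzero d nz zero = ∏P-nonzero (d ∘ suc) (nz ∘ suc)
  cofactor-nonzero d nz (suc a) = *P-nonzero (cofactor (d ∘ suc) a) (d zero) (cofactor-nonzero (d ∘ suc) (nz ∘ suc) a) (nz zero)

  -- Multiplication by a single term translates exponents by `u`, which `δ-shift` undoes. The term
  -- stands in the middle, as a matrix entry stands between the numerator and the cofactor of its
  -- arc.
  shifted-term : ∀ {n} (f g : Poly n) ε u m →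
    evalAt (δ (m ⊕ u)) ((f *P ((ε , u) ∷ [])) *P g) ≡ ε ℤ.* coeff (f *P g) m
  shifted-term f g ε u m = begin
    evalAt (δ (m ⊕ u)) ((f *P ((ε , u) ∷ [])) *P g)
      ≡⟨ evalAt-*P _ (f *P ((ε , u) ∷ [])) g ⟩
    evalAt (λ s → evalAt (λ t → δ (m ⊕ u) (s ⊕ t)) g) (f *P ((ε , u) ∷ []))
      ≡⟨ evalAt-*P _ f ((ε , u) ∷ []) ⟩
    evalAt (λ s → ε ℤ.* evalAt (λ t → δ (m ⊕ u) ((s ⊕ u) ⊕ t)) g ℤ.+ + 0) f
      ≡⟨ evalAt-cong (λ s → trans (ℤP.+-identityʳ _) (cong (ε ℤ.*_)
           (evalAt-cong (λ t → trans (cong (δ (m ⊕ u)) (⊕-swapʳ s u t)) (δ-shift m (s ⊕ t) u)) g))) f ⟩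
    evalAt (λ s → ε ℤ.* evalAt (λ t → δ m (s ⊕ t)) g) f
      ≡⟨ evalAt-scale ε _ f ⟩
    ε ℤ.* evalAt (λ s → evalAt (λ t → δ m (s ⊕ t)) g) f
      ≡⟨ cong (ε ℤ.*_) (trans (coeff≡evalAt-δ (f *P g) m) (evalAt-*P _ f g)) ⟨
    ε ℤ.* coeff (f *P g) m ∎
    where open ≡-Reasoning

  term-support : ∀ {n} (f g : Poly n) ε u M →
    evalAt (δ M) ((f *P ((ε , u) ∷ [])) *P g) ≢₀ → ∃[ m ] (M ≡ m ⊕ u × coeff (f *P g) m ≢₀)
  -- Unfolding the evaluation yields `s` and `t` that exhibit `M` as a multiple of `u`;
  -- `shifted-term` then carries nonvanishing over to the quotient `s ⊕ t`.
  term-support f g ε u M nz = s ⊕ t , M≡ , λ z → nz (subst (λ M → evalAt (δ M) ((f *P ((ε , u) ∷ [])) *P g) ≡₀) (sym M≡)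
      (subst _≡₀ (sym (shifted-term f g ε u (s ⊕ t))) (*-≡₀ʳ ε z)))
    where
    inner = λ s → evalAt (λ t → δ M ((s ⊕ u) ⊕ t)) g
    expand : evalAt (δ M) ((f *P ((ε , u) ∷ [])) *P g) ≡ evalAt (λ s → ε ℤ.* inner s ℤ.+ + 0) f
    expand = trans (evalAt-*P _ (f *P ((ε , u) ∷ [])) g) (evalAt-*P _ f ((ε , u) ∷ []))
    witness₁ = evalAt-witness f (subst _≢₀ expand nz)
    s = proj₁ witness₁
    witness₂ = evalAt-witness g (λ z → proj₂ witness₁ (+-≡₀ (*-≡₀ʳ ε z) 0≡₀))
    t = proj₁ witness₂
    M≡ : M ≡ (s ⊕ t) ⊕ u
    M≡ = trans (sym (δ-≢₀ (proj₂ witness₂))) (⊕-swapʳ s u t)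

  empty-term : ∀ {n} (f g : Poly n) M → evalAt (δ M) ((f *P []) *P g) ≡₀
  empty-term f g M = decidable-stable (_ ≡₀?) λ nz →
    proj₂ (evalAt-witness f (subst _≢₀ (trans (evalAt-*P (δ M) (f *P []) g) (evalAt-*P _ f [])) nz)) 0≡₀

-- Repetitions in sequences over a finite set

InjectiveBelow : ∀ {N} → (ℕ → Fin N) → ℕ → Set
InjectiveBelow f t = ∀ {a b} → a ℕ.< b → b ℕ.< t → f a ≢ f b

RepeatAt : ∀ {N} → (ℕ → Fin N) → ℕ → Set
RepeatAt f j = ∃[ i ] (i ℕ.< j × f i ≡ f j)

firstRepeatBelow : ∀ {N} (f : ℕ → Fin N) t →
  InjectiveBelow f t ⊎ (∃[ j ] (j ℕ.< t × RepeatAt f j × InjectiveBelow f j))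
firstRepeatBelow f zero = inj₁ λ _ ()
firstRepeatBelow f (suc t) with firstRepeatBelow f t
... | inj₂ (j , j<t , rest) = inj₂ (j , ℕP.m<n⇒m<1+n j<t , rest)
... | inj₁ inj with ℕP.anyUpTo? (λ i → f i Fin.≟ f t) t
...   | yes (i , i<t , eq) = inj₂ (t , ℕP.n<1+n t , (i , i<t , eq) , inj)
...   | no new = inj₁ extended
  where
  extended : InjectiveBelow f (suc t)
  extended {a} {b} a<b b<1+t eq with ℕP.m≤n⇒m<n∨m≡n (s≤s⁻¹ b<1+t)
  ... | inj₁ b<t = inj a<b b<t eq
  ... | inj₂ refl = new (a , a<b , eq)

-- By pigeonhole. Taking the first repetition keeps all earlier entries distinct, which is the
-- injectivity that cycles and trails require.
firstRepeat : ∀ {N} (f : ℕ → Fin N) → ∃[ j ] (j ℕ.≤ N × RepeatAt f j × InjectiveBelow f j)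
firstRepeat {N} f with firstRepeatBelow f (suc N)
... | inj₂ (j , j<1+N , rest) = j , s≤s⁻¹ j<1+N , rest
... | inj₁ inj =
  let (x , y , x<y , eq) = FinP.pigeonhole (ℕP.n<1+n N) (f ∘ toℕ)
  in contradiction eq (inj x<y (FinP.toℕ<n y))

cyc-toℕ : ∀ {k} (i : Fin (suc k)) → (toℕ i ≡ k × cyc i ≡ zero) ⊎ (toℕ (cyc i) ≡ suc (toℕ i))
cyc-toℕ {zero} zero = inj₁ (refl , refl)
cyc-toℕ {suc k} zero = inj₂ refl
cyc-toℕ {suc k} (suc i) with cyc {k} i | cyc-toℕ i
... | zero | inj₁ (eq , _) = inj₁ (cong suc eq , refl)
... | suc j | inj₂ eq = inj₂ (cong suc eq)

injective-segment : ∀ {N} (f : ℕ → Fin N) b {k j} → b ℕ.+ k ≡ j → InjectiveBelow f j →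
  {x y : Fin k} → f (b ℕ.+ toℕ x) ≡ f (b ℕ.+ toℕ y) → x ≡ y
injective-segment f b {k} refl inj {x} {y} eq with ℕP.<-cmp (toℕ x) (toℕ y)
... | tri< x<y _ _ = contradiction eq (inj (ℕP.+-monoʳ-< b x<y) (ℕP.+-monoʳ-< b (FinP.toℕ<n y)))
... | tri≈ _ x≡y _ = FinP.toℕ-injective x≡y
... | tri> _ _ y<x = contradiction (sym eq) (inj (ℕP.+-monoʳ-< b y<x) (ℕP.+-monoʳ-< b (FinP.toℕ<n x)))

evenOrOdd : ∀ d → ∃[ m ] (d ≡ 2 ℕ.* m ⊎ d ≡ suc (2 ℕ.* m))
evenOrOdd zero = 0 , inj₁ refl
evenOrOdd (suc d) with evenOrOdd d
... | m , inj₁ eq = m , inj₂ (cong suc eq)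
... | m , inj₂ eq = suc m , inj₁ (trans (cong suc eq) (cong suc (sym (ℕP.+-suc m (m ℕ.+ 0)))))

-- Walks in the oriented graph

module Oriented {n} (G : List (Edge n)) (o : Orientation G) (loopless : ∀ a → tail G o a ≢ head G o a) where

  Arc : Set
  Arc = Fin (length G)

  endpoint : Bool → Arc → Fin n
  endpoint true = head G o
  endpoint false = tail G o

  endpoint-≢ : ∀ s a → endpoint s a ≢ endpoint (not s) a
  endpoint-≢ true a = loopless a ∘ sym
  endpoint-≢ false a = loopless a

  Adjacent : Fin n → Fin n → Set
  Adjacent u v = ∃[ a ] (tail G o a ≡ u × head G o a ≡ v)

  ¬adjacent-self : ∀ v → ¬ Adjacent v v
  ¬adjacent-self v (a , t , h) = loopless a (trans t (sym h))

  -- The sequence is infinite so that `firstRepeat` applies directly; its values after step `t` are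
  -- unconstrained.
  Walk : ℕ → Fin n → Set
  Walk t v = Σ (ℕ → Fin n) λ f → f 0 ≡ v × (∀ i → i ℕ.< t → Adjacent (f i) (f (suc i)))

  -- The first repeated vertex occurs within the first `n` steps, hence inside the walk, and the
  -- segment between the two visits closes up.
  cycleFromWalk : ∀ {t v} → n ℕ.≤ t → Walk t v → DirectedCycle G o
  cycleFromWalk {t} n≤t (f , _ , arcs) with firstRepeat f
  ... | j , j≤n , (i , i<j , fi≡fj) , inj = go (j ℕ.∸ suc i) (trans (ℕP.+-suc i _) (ℕP.m+[n∸m]≡n i<j))
    where
    go : ∀ d → i ℕ.+ suc d ≡ j → DirectedCycle G o
    -- A return after one step would be a loop, so the cycle has at least two vertices.
    go zero eq = contradiction (arcs i (ℕP.<-≤-trans i<j (ℕP.≤-trans j≤n n≤t)))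
      (subst (λ v → ¬ Adjacent (f i) v) (trans fi≡fj (cong f (trans (sym eq) (ℕP.+-comm i 1)))) (¬adjacent-self (f i)))
    go (suc k) eq = k , (λ x → f (i ℕ.+ toℕ x)) , injective-segment f i eq inj , step
      where
      step : ∀ x → Adjacent (f (i ℕ.+ toℕ x)) (f (i ℕ.+ toℕ (cyc x)))
      step x = subst (Adjacent _) next-vertex (arcs (i ℕ.+ toℕ x)
          (ℕP.<-≤-trans (ℕP.+-monoʳ-< i (FinP.toℕ<n x)) (ℕP.≤-trans (ℕP.≤-reflexive eq) (ℕP.≤-trans j≤n n≤t))))
        where
        next-vertex : f (suc (i ℕ.+ toℕ x)) ≡ f (i ℕ.+ toℕ (cyc x))
        next-vertex with cyc-toℕ x
        ... | inj₂ x+1 = cong f (trans (sym (ℕP.+-suc i _)) (cong (i ℕ.+_) (sym x+1)))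
        ... | inj₁ (x≡last , c≡0) rewrite c≡0 | ℕP.+-identityʳ i =
          trans (cong f (trans (sym (ℕP.+-suc i _)) (trans (cong (λ z → i ℕ.+ suc z) x≡last) eq))) (sym fi≡fj)

  -- Heights in an acyclic orientation

  relax : (Fin n → ℕ) → Fin n → Arc → ℕ
  relax h v a with tail G o a Fin.≟ v
  ... | yes _ = suc (h (head G o a))
  -- Arcs not leaving `v` contribute the neutral value of `max`.
  ... | no _ = 0

  -- The maximal length, capped at t, of a directed walk from a vertex.
  height : ℕ → Fin n → ℕ
  height zero v = 0
  height (suc t) v = max 0 (List.map (relax (height t) v) (allFin (length G)))

  relax-self : ∀ h a → relax h (tail G o a) a ≡ suc (h (head G o a))
  relax-self h a with tail G o a Fin.≟ tail G o a
  ... | yes _ = refl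
  ... | no ≢ = contradiction refl ≢

  height-arc : ∀ t a → height t (head G o a) ℕ.< height (suc t) (tail G o a)
  height-arc t a = subst (ℕ._≤ height (suc t) (tail G o a)) (relax-self (height t) a)
    (All.lookup (xs≤max 0 _) (∈-map⁺ (relax (height t) (tail G o a)) (∈-allFin a)))

  relax-cong : ∀ h h′ v a → (tail G o a ≡ v → h (head G o a) ≡ h′ (head G o a)) → relax h v a ≡ relax h′ v a
  relax-cong h h′ v a eq with tail G o a Fin.≟ v
  ... | yes ta≡v = cong suc (eq ta≡v)
  ... | no _ = refl

  relax-none : ∀ h v a → tail G o a ≢ v → relax h v a ≡ 0
  relax-none h v a ta≢v with tail G o a Fin.≟ v
  ... | yes ta≡v = contradiction ta≡v ta≢v
  ... | no _ = refl

  extendWalk : ∀ {t v a} → tail G o a ≡ v → Walk t (head G o a) → Walk (suc t) v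
  extendWalk {v = v} {a} ta≡v (f , f0 , arcs) =
    (λ { zero → v ; (suc i) → f i }) , refl ,
    λ { zero _ → a , ta≡v , sym f0 ; (suc i) (s≤s i<t) → arcs i i<t }

  -- If the value at `v` still changes in a round, then in the round before it changed at the head
  -- of some arc leaving `v`; tracing the changes back traces out the walk.
  walkFromGrowth : ∀ t v → height (suc t) v ≢ height t v → Walk (suc t) v
  walkFromGrowth zero v grows with FinP.any? (λ a → tail G o a Fin.≟ v)
  ... | yes (a , ta≡v) = extendWalk ta≡v ((λ _ → head G o a) , refl , λ _ ())
  ... | no none = contradiction
    (ℕP.n≤0⇒n≡0 (max≤v⁺ {xs = List.map _ (allFin (length G))} z≤n
      (AllP.map⁺ (All.universal (λ a → ℕP.≤-reflexive (relax-none (height 0) v a (λ eq → none (a , eq)))) _))))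
    grows
  walkFromGrowth (suc t) v grows
    with FinP.any? (λ a → (tail G o a Fin.≟ v) ×-dec ¬? (height (suc t) (head G o a) ℕ.≟ height t (head G o a)))
  ... | yes (a , ta≡v , h-grows) = extendWalk ta≡v (walkFromGrowth t (head G o a) h-grows)
  ... | no none = contradiction
    (cong (max 0) (map-cong (λ a → relax-cong (height (suc t)) (height t) v a
      (λ ta≡v → decidable-stable (_ ℕ.≟ _) (λ ≢ → none (a , ta≡v , ≢)))) (allFin (length G))))
    grows

  -- One more round always lifts a tail strictly above the head. Growth in round `n + 1` would give
  -- a walk long enough to contain a cycle, so that round changes nothing.
  acyclic-height : ¬ DirectedCycle G o → ∀ a → height n (head G o a) ℕ.< height n (tail G o a)
  acyclic-height acyclic a = subst (height n (head G o a) ℕ.<_) stable (height-arc n a)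
    where
    stable : height (suc n) (tail G o a) ≡ height n (tail G o a)
    stable = decidable-stable (_ ℕ.≟ _) λ grows →
      acyclic (cycleFromWalk (ℕP.n≤1+n n) (walkFromGrowth n (tail G o a) grows))

  -- `s i` names the end of `w i` that it shares with `w (suc i)`: `true` for the head, `false` for
  -- the tail.
  module _ (w : ℕ → Arc) (s : ℕ → Bool) (alternates : ∀ i → s (suc i) ≡ not (s i))
           (links : ∀ i → endpoint (s i) (w i) ≡ endpoint (s i) (w (suc i)))
           (moves : ∀ i → w i ≢ w (suc i)) where

    s-even : ∀ i m → s (2 ℕ.* m ℕ.+ i) ≡ s i
    s-even i zero = refl
    s-even i (suc m) = trans (cong s (cong (λ z → suc z ℕ.+ i) (ℕP.+-suc m (m ℕ.+ 0))))
      (trans (alternates _) (trans (cong not (alternates _)) (trans (not-involutive _) (s-even i m))))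

    -- Even length makes the sides alternate across the seam as well. Consecutive vertices of the
    -- trail are then opposite ends of one arc, hence distinct.
    closeTrail : ∀ b m {j} → b ℕ.+ 2 ℕ.* suc m ≡ suc j → InjectiveBelow w (suc j) →
      endpoint (s j) (w j) ≡ endpoint (s j) (w b) → AlternatingClosedTrail G o
    closeTrail b m {j} len inj wraps = m , e , v , injective-segment w b len inj , λ i → shared i , v-moves i
      where
      e : Fin (2 ℕ.* suc m) → Arc
      e i = w (b ℕ.+ toℕ i)
      side : Fin (2 ℕ.* suc m) → Bool
      side i = s (b ℕ.+ toℕ i)
      v : Fin (2 ℕ.* suc m) → Fin n
      v i = endpoint (side i) (e i)
      len′ : b ℕ.+ (m ℕ.+ suc (m ℕ.+ 0)) ≡ j
      len′ = ℕP.suc-injective (trans (sym (ℕP.+-suc b _)) len)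
      side-wrap : s j ≡ not (s b)
      side-wrap = trans (cong s (trans (sym len′) (trans (cong (b ℕ.+_) (ℕP.+-suc m (m ℕ.+ 0)))
          (trans (ℕP.+-suc b _) (cong suc (ℕP.+-comm b _)))))) (trans (alternates _) (cong not (s-even b m)))
      arrives : ∀ i → endpoint (side i) (e (cyc i)) ≡ v i × side (cyc i) ≡ not (side i)
      arrives i with cyc-toℕ i
      ... | inj₂ i+1 rewrite i+1 | ℕP.+-suc b (toℕ i) = sym (links _) , alternates _
      ... | inj₁ (i≡last , c≡0) rewrite c≡0 | i≡last | len′ | ℕP.+-identityʳ b =
        sym wraps , trans (sym (not-involutive _)) (cong not (sym side-wrap))
      shared : ∀ i → (head G o (e i) ≡ v i × head G o (e (cyc i)) ≡ v i)
                   ⊎ (tail G o (e i) ≡ v i × tail G o (e (cyc i)) ≡ v i)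
      shared i with side i | proj₁ (arrives i)
      ... | true | eq = inj₁ (refl , eq)
      ... | false | eq = inj₂ (refl , eq)
      v-moves : ∀ i → v i ≢ v (cyc i)
      v-moves i eq = endpoint-≢ (side i) (e (cyc i))
        (trans (proj₁ (arrives i)) (trans eq (cong (λ z → endpoint z (e (cyc i))) (proj₂ (arrives i)))))

    -- Let w i = w j be the first repetition.  If both visits use the arc in the same direction, the arcs from w i on
    -- close up; otherwise the trail returns along w i to the vertex it left it by, and w i itself is dropped.
    trailFromAlternatingWalk : AlternatingClosedTrail G o
    trailFromAlternatingWalk with firstRepeat w
    ... | j , _ , (i , i<j , wi≡wj) , inj with ℕP.m+[n∸m]≡n (ℕP.<⇒≤ i<j) | evenOrOdd (j ℕ.∸ i)
    ...   | len | zero , inj₁ d≡0 = contradiction (trans (sym (ℕP.+-identityʳ i)) (trans (cong (i ℕ.+_) (sym d≡0)) len)) (ℕP.<⇒≢ i<j)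
    trailFromAlternatingWalk | suc j , _ , (i , i<j , wi≡wj) , inj | len | suc m , inj₁ d≡ =
      closeTrail i m (trans (cong (i ℕ.+_) (sym d≡)) len) inj
        (trans (links j) (cong (endpoint (s j)) (sym wi≡wj)))
    trailFromAlternatingWalk | j , _ , (i , i<j , wi≡wj) , inj | len | zero , inj₂ d≡ =
      contradiction (trans wi≡wj (cong w (trans (sym len) (trans (cong (i ℕ.+_) d≡) (ℕP.+-comm i 1))))) (moves i)
    trailFromAlternatingWalk | suc j , _ , (i , i<j , wi≡wj) , inj | len | suc m , inj₂ d≡ =
      closeTrail (suc i) m len′ inj
        (trans (links j) (trans (cong (endpoint (s j)) (sym wi≡wj)) returns))
      where
      len′ : suc i ℕ.+ 2 ℕ.* suc m ≡ suc j
      len′ = trans (sym (ℕP.+-suc i _)) (trans (cong (i ℕ.+_) (sym d≡)) len)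
      same-side : s j ≡ s i
      same-side = trans (cong s (trans (sym (ℕP.suc-injective len′)) (ℕP.+-comm i _))) (s-even i (suc m))
      returns : endpoint (s j) (w i) ≡ endpoint (s j) (w (suc i))
      returns = subst (λ z → endpoint z (w i) ≡ endpoint z (w (suc i))) (sym same-side) (links i)

-- The top-weight part of a dependency

entry-cases : ∀ {n} (e : Edge n) k t →
    (k ≡ proj₁ e × entry e k t ≡ (+ 1 , varM (proj₂ e) t) ∷ [])
  ⊎ (k ≡ proj₂ e × entry e k t ≡ (ℤ.-1ℤ , varM (proj₁ e) t) ∷ [])
  ⊎ (k ≢ proj₁ e × k ≢ proj₂ e × entry e k t ≡ [])
entry-cases (i , j) k t with k Fin.≟ i | k Fin.≟ j
entry-cases (i , j) k true | yes k≡i | _ = inj₁ (k≡i , refl)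
entry-cases (i , j) k false | yes k≡i | _ = inj₁ (k≡i , refl)
entry-cases (i , j) k true | no _ | yes k≡j = inj₂ (inj₁ (k≡j , refl))
entry-cases (i , j) k false | no _ | yes k≡j = inj₂ (inj₁ (k≡j , refl))
entry-cases (i , j) k t | no k≢i | no k≢j = inj₂ (inj₂ (k≢i , k≢j , refl))

weight-⊕ : ∀ {n} (N : Fin n → ℕ) x y → weight N (x ⊕ y) ≡ weight N x ℕ.+ weight N y
weight-⊕ N (a , _) (c , _) = weightV-+ N a c

weight-varB : ∀ {n} (N : Fin n → ℕ) m j → weight N (m ⊕ varM j false) ≡ weight N m
weight-varB N m j = trans (weight-⊕ N m (varM j false)) (trans (cong (weight N m ℕ.+_) (weightV-0 N)) (ℕP.+-identityʳ _))

weight-varR : ∀ {n} (N : Fin n → ℕ) m j → weight N (m ⊕ varM j true) ≡ weight N m ℕ.+ N j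
weight-varR N m j = trans (weight-⊕ N m (varM j true)) (cong (weight N m ℕ.+_) (weightV-unit N j))

module Dependency
  {n} (G : List (Edge n)) (o : Orientation G) (loopless : ∀ a → tail G o a ≢ head G o a)
  (N : Fin n → ℕ) (descends : ∀ a → N (head G o a) ℕ.< N (tail G o a))
  (p : ℕ) (euclid : ∀ x y → p ℕD.∣ x ℕ.* y → p ℕD.∣ x ⊎ p ℕD.∣ y) (p∤1 : ¬ p ℕD.∣ 1)
  (c : Fin (length G) → Frac n) (dependent : ∀ k t → IsZeroF p (columnSum G c k t))
  where

  open Modulo p euclid p∤1
  open Oriented G o loopless

  cof : Arc → Poly n
  cof = cofactor (den ∘ c)

  W : Arc → Poly n
  W a = num (c a) *P cof a

  -- The contribution of an arc to the coefficient of `M` in column `(k , t)` once denominators are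
  -- cleared.
  term : Fin n → Bool → Monomial n → Arc → ℤ
  term k t M a = evalAt (δ M) ((num (c a) *P entry (lookup G a) k t) *P cof a)

  balance : ∀ k t M → Σ[] (term k t M) ≡₀
  balance k t M = subst _≡₀
    (trans (coeff≡evalAt-δ (num (columnSum G c k t)) M)
           (evalAt-num-sumF (δ M) (λ a → c a *FP entry (lookup G a) k t) id))
    (mk≡₀ (dependent k t M))

  -- The sign depends on the order of the two vertices and not on the orientation; only its being a
  -- unit matters, so it is recorded by absolute value.
  IncidentEntry : Arc → Bool → Fin n → Bool → Set
  IncidentEntry a s k t =
    k ≡ endpoint s a × ∃[ ε ] (∣ ε ∣ ≡ 1 × entry (lookup G a) k t ≡ (ε , varM (endpoint (not s) a) t) ∷ [])

  arc-entry : ∀ a k t → (∃[ s ] IncidentEntry a s k t) ⊎ ((∀ s → k ≢ endpoint s a) × entry (lookup G a) k t ≡ [])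
  arc-entry a k t with o a in oa | entry-cases (lookup G a) k t
  ... | true | inj₁ (k≡ , eq) = inj₁ (false , incident)
    where
    incident : IncidentEntry a false k t
    incident rewrite oa = k≡ , _ , refl , eq
  ... | true | inj₂ (inj₁ (k≡ , eq)) = inj₁ (true , incident)
    where
    incident : IncidentEntry a true k t
    incident rewrite oa = k≡ , _ , refl , eq
  ... | false | inj₁ (k≡ , eq) = inj₁ (true , incident)
    where
    incident : IncidentEntry a true k t
    incident rewrite oa = k≡ , _ , refl , eq
  ... | false | inj₂ (inj₁ (k≡ , eq)) = inj₁ (false , incident)
    where
    incident : IncidentEntry a false k t
    incident rewrite oa = k≡ , _ , refl , eq
  ... | b | inj₂ (inj₂ (k≢i , k≢j , eq)) = inj₂ (apart b oa , eq)
    where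
    apart : ∀ b → o a ≡ b → ∀ s → k ≢ endpoint s a
    apart true oa true rewrite oa = k≢j
    apart true oa false rewrite oa = k≢i
    apart false oa true rewrite oa = k≢i
    apart false oa false rewrite oa = k≢j

  -- The Boolean `s` selects an end and a column together: the r-column at the head, the b-column at
  -- the tail. The entry there is, up to sign, the variable of the other end.
  own-term : ∀ a m s → coeff (W a) m ≢₀ → term (endpoint s a) s (m ⊕ varM (endpoint (not s) a) s) a ≢₀
  own-term a m s nz with arc-entry a (endpoint s a) s
  ... | inj₂ (apart , _) = contradiction refl (apart s)
  ... | inj₁ (s′ , k≡ , ε , ∣ε∣≡1 , eq) with s′ Bool.≟ s
  -- Incidence at the other end as well would make the arc a loop.
  ...   | no s′≢s = contradiction (trans k≡ (cong (λ z → endpoint z a) (¬-not s′≢s))) (endpoint-≢ s a)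
  ...   | yes refl rewrite eq = subst _≢₀ (sym (shifted-term (num (c a)) (cof a) ε _ m)) (unit-*-≢₀ {ε} ∣ε∣≡1 nz)

  other-term : ∀ b k t M → term k t M b ≢₀ →
    ∃₂ λ s m → k ≡ endpoint s b × M ≡ m ⊕ varM (endpoint (not s) b) t × coeff (W b) m ≢₀
  other-term b k t M nz with arc-entry b k t
  ... | inj₁ (s , k≡ , ε , _ , eq) rewrite eq =
    let (m , M≡ , m-nz) = term-support (num (c b)) (cof b) ε _ M nz in s , m , k≡ , M≡ , m-nz
  ... | inj₂ (_ , eq) rewrite eq = contradiction (empty-term (num (c b)) (cof b) M) nz

  -- Chosen so that a column and a target monomial determine it: it is the weight of that monomial
  -- in the r-column at a head, and this weight plus `N k` in the b-column at a tail `k`.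
  μ : Arc → Monomial n → ℕ
  μ a m = weight N m ℕ.+ N (tail G o a)

  module Top (D : ℕ) (top : ∀ a m → coeff (W a) m ≢₀ → μ a m ℕ.≤ D) where

    record State : Set where
      field
        arc : Arc
        mono : Monomial n
        nonzero : coeff (W arc) mono ≢₀
        extremal : μ arc mono ≡ D
    open State

    μ-same-side : ∀ s {a b m m′} → endpoint s a ≡ endpoint s b →
      m ⊕ varM (endpoint (not s) a) s ≡ m′ ⊕ varM (endpoint (not s) b) s → μ a m ≡ μ b m′
    μ-same-side false {a} {b} {m} {m′} k≡ M≡ = cong₂ ℕ._+_
      (trans (sym (weight-varB N m (endpoint true a))) (trans (cong (weight N) M≡) (weight-varB N m′ (endpoint (not false) b)))) (cong N k≡)
    μ-same-side true {a} {b} {m} {m′} k≡ M≡ =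
      trans (sym (weight-varR N m _)) (trans (cong (weight N) M≡) (weight-varR N m′ _))

    -- An arc meeting the vertex with the wrong end is strictly heavier: since `N` drops along `b`,
    -- its tail exceeds the height that the column accounts for.
    μ-opposite-side : ∀ s {a b m m′} → endpoint s a ≡ endpoint (not s) b →
      m ⊕ varM (endpoint (not s) a) s ≡ m′ ⊕ varM (endpoint s b) s → μ a m ℕ.< μ b m′
    μ-opposite-side false {a} {b} {m} {m′} k≡ M≡ = ℕP.+-mono-≤-<
      (ℕP.≤-reflexive (trans (sym (weight-varB N m (endpoint true a))) (trans (cong (weight N) M≡) (weight-varB N m′ (endpoint false b)))))
      (subst (ℕ._< N (tail G o b)) (cong N (sym k≡)) (descends b))
    μ-opposite-side true {a} {b} {m} {m′} k≡ M≡ = ℕP.≤-<-trans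
      (ℕP.≤-reflexive (trans (sym (weight-varR N m _)) (trans (cong (weight N) M≡) (weight-varR N m′ _))))
      (ℕP.+-monoʳ-< (weight N m′) (descends b))

    -- The nonzero term of `x` must be cancelled in its column. Maximality of `D` makes the
    -- cancelling arc meet the vertex with the same end, and then its `μ` is again `D`.
    step : ∀ s (x : State) → Σ State λ y → endpoint s (arc x) ≡ endpoint s (arc y) × arc x ≢ arc y
    step s x with another-term (arc x) (balance (endpoint s (arc x)) s (mono x ⊕ varM (endpoint (not s) (arc x)) s))
                    (own-term (arc x) (mono x) s (nonzero x))
    ... | b , b≢a , b-nz with other-term b _ s _ b-nz
    ...   | s′ , m′ , k≡ , M≡ , m′-nz with s′ Bool.≟ s
    ...     | yes refl = record
      { arc = b ; mono = m′ ; nonzero = m′-nz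
      ; extremal = trans (sym (μ-same-side s k≡ M≡)) (extremal x) } , k≡ , b≢a ∘ sym
    ...     | no s′≢s rewrite ¬-not s′≢s | not-involutive s = contradiction (top b m′ m′-nz)
      (ℕP.<⇒≱ (subst (ℕ._< μ b m′) (extremal x) (μ-opposite-side s k≡ M≡)))

    trail : State → AlternatingClosedTrail G o
    trail x₀ = trailFromAlternatingWalk (arc ∘ state) side (λ _ → refl)
      (λ i → proj₁ (proj₂ (step (side i) (state i)))) (λ i → proj₂ (proj₂ (step (side i) (state i))))
      where
      side : ℕ → Bool
      side zero = false
      side (suc i) = not (side i)
      state : ℕ → State
      state zero = x₀
      state (suc i) = proj₁ (step (side i) (state i))

  weights-vanish : ¬ AlternatingClosedTrail G o → ∀ a m → coeff (W a) m ≡₀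
  weights-vanish no-trail a m = decidable-stable (coeff (W a) m ≡₀?) λ nz →
    -- Nonzero coefficients occur only at listed monomials, so a maximum over a finite list
    -- suffices; its value becomes the bound `D` of `Top`.
    let ((b , m′) , b-nz , b-max) = maximal ℕP.≤-totalOrder (λ (b , m) → μ b m) (λ (b , m) → ¬? (coeff (W b) m ≡₀?))
                                      candidates ((a , m) , nz)
    in no-trail (Top.trail (μ b m′) (λ a m nz → b-max (candidate nz) nz)
         (record { arc = b ; mono = m′ ; nonzero = b-nz ; extremal = refl }))
    where
    row : Arc → List (Arc × Monomial n)
    row a = List.map (a ,_) (List.map proj₂ (W a))
    candidates : List (Arc × Monomial n)
    candidates = List.concatMap row (allFin (length G))
    candidate : ∀ {a m} → coeff (W a) m ≢₀ → (a , m) ∈ candidates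
    candidate {a} nz = ∈-concatMap⁺ row (lose (∈-allFin a) (∈-map⁺ (a ,_) (coeff-support (W a) nz)))

  numerators-vanish : (∀ a → ¬ IsZeroP p (den (c a))) → ¬ AlternatingClosedTrail G o → ∀ a → IsZeroF p (c a)
  numerators-vanish den-nz no-trail a m = divides (decidable-stable (coeff (num (c a)) m ≡₀?) λ nz →
    -- A nonzero numerator times the nonzero product of the other denominators would be a nonzero
    -- `W a`.
    let (M , M-nz) = *P-nonzero (num (c a)) (cof a) (m , nz)
                       (cofactor-nonzero (den ∘ c) (λ a → nonzeroP (den (c a)) (den-nz a)) a)
    in M-nz (weights-vanish no-trail a M))

-- Looplessness, admissible characteristics and conclusion

loopless : ∀ {n} {G : List (Edge n)} → IsGraph G → ∀ o a → tail G o a ≢ head G o a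
loopless {G = G} (ordered , _) o a with o a | All.lookup ordered (∈-lookup {xs = G} a)
... | true | i<j = λ eq → FinP.<-irrefl eq i<j
... | false | i<j = λ eq → FinP.<-irrefl (sym eq) i<j

-- For `p = 0` divisibility means vanishing, and the claim is that the natural numbers have no zero
-- divisors.
prime-or-0-euclid : ∀ {p} → Prime p ⊎ p ≡ 0 → ∀ x y → p ℕD.∣ x ℕ.* y → p ℕD.∣ x ⊎ p ℕD.∣ y
prime-or-0-euclid (inj₁ pr) x y = euclidsLemma x y pr
prime-or-0-euclid (inj₂ refl) x y 0∣xy with ℕP.m*n≡0⇒m≡0∨n≡0 x (ℕD.0∣⇒≡0 0∣xy)
... | inj₁ refl = inj₁ ℕD.∣-refl
... | inj₂ refl = inj₂ ℕD.∣-refl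

prime-or-0-∤1 : ∀ {p} → Prime p ⊎ p ≡ 0 → ¬ p ℕD.∣ 1
prime-or-0-∤1 (inj₁ pr) p∣1 = ¬prime[1] (subst Prime (ℕD.∣1⇒≡1 p∣1) pr)
prime-or-0-∤1 (inj₂ refl) 0∣1 with () ← ℕD.0∣⇒≡0 0∣1

theorem1p12 : (n : ℕ) (G : List (Edge n)) → IsGraph G → BernsteinOrientable G →
    (p : ℕ) → (Prime p ⊎ p ≡ 0) → HIndependent n p G
theorem1p12 n G graph (o , acyclic , no-trail) p p-char c den-nz dependent =
  -- The heights after `n` rounds serve as the weights `N` of the variables r.
  Dependency.numerators-vanish G o simple (height n) (acyclic-height acyclic)
    p (prime-or-0-euclid p-char) (prime-or-0-∤1 p-char) c dependent den-nz no-trail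
  where
  simple = loopless graph o
  open Oriented G o simple
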